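{- Let $U=U_1\times\cdots\times U_m$ with $U_i=\{0,1,\dots,|U_i|-1\}$ finite and nonempty for each $i$. A set $S\subseteq U$ is ample if and only if every serial push down commutes on $S$, i.e., for any sequence of one-dimensional minor-subproducts $M^1,M^2,\dots,M^k$ of $U$ with pairwise distinct supports and any permutation $M^{i_1},M^{i_2},\dots,M^{i_k}$ of it, we have $S[M^1,M^2,\dots,M^k\downarrow]=S[M^{i_1},M^{i_2},\dots,M^{i_k}\downarrow]$.
   Context: A generalized partition of $U$ is a tuple $\Lambda=(\alpha_1,\dots,\alpha_m)$ with $\alpha_i$ a partition of $U_i$ into nonempty blocks. It defines a partition of $U$ into the boxes $P^1\times\cdots\times P^m$, $P^i\in\alpha_i$, and the minor-subproduct $M=M(\Lambda)=M_1\times\cdots\times M_m$, where $M_i$ is the set of blocks of $\alpha_i$. The support of $M$ is the set of $i$ such that $\alpha_i$ has a non-singleton block; $M$ is one-dimensional if its support has exactly one element. $M(\Lambda)$ is shattered by $S\subseteq U$ if $S$ meets every box of the box-partition. A copy of $M(\Lambda)$ is a set $W_1\times\cdots\times W_m$ where $W_i$ consists of exactly one element from each block of $\alpha_i$. $M(\Lambda)$ is strongly shattered by $S$ if $S$ contains a copy of it. $S$ is ample if every minor-subproduct of $U$ shattered by $S$ is strongly shattered by $S$. Push down: let $M$ be one-dimensional with support $\{i\}$. Every box $B$ of its box-partition consists of tuples which differ only in their $i$-th coordinate. $S[M\downarrow]$ is the set such that, for every box $B$ of the box-partition, $S[M\downarrow]\cap B$ consists of the $|S\cap B|$ elements of $B$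 with the smallest $i$-th coordinates. The serial push down is $S[M^1,\dots,M^k\downarrow]=S[M^1\downarrow][M^2\downarrow]\cdots[M^k\downarrow]$ (applied from left to right). -}

module Defs where

open import Data.Bool.Base using (Bool; T)
open import Data.Bool.Properties using (T?)
open import Data.Fin.Base using (Fin) renaming (_<_ to _<ᶠ_)
open import Data.Fin.Properties using (all?) renaming (_<?_ to _<ᶠ?_)
open import Data.Fin.Subset using (Subset; _∈_; Nonempty; ∣_∣)
open import Data.Fin.Subset.Properties using (_∈?_)
open import Data.List.Base using (List; []; _∷_; length; filter; foldl; map; allFin; cartesianProductWith)
open import Data.List.Relation.Binary.Permutation.Propositional using (_↭_)
open import Data.List.Relation.Unary.Unique.Propositional using (Unique)
open import Data.Nat.Base using (ℕ)
open import Data.Nat.Properties using (_<?_)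
open import Data.Product using (∃; ∃!; _×_; proj₁)
open import Data.Vec.Base using (Vec; []; _∷_)
open import Data.Vec.Relation.Unary.All using (All; []; _∷_)
open import Data.Vec.Relation.Unary.All.Properties using () renaming (lookup⁺ to lookup)
open import Relation.Binary.PropositionalEquality using (_≡_; _≢_)
open import Relation.Nullary.Decidable using (⌊_⌋; _×-dec_)
open import Relation.Unary using (Pred; Decidable)
open import Level using (0ℓ)

-- U ns is U₁ × ⋯ × Uₘ with Uᵢ = {0, …, nsᵢ - 1}.  An inductive tuple is used
-- rather than a function on Fin m so that equality needs no extensionality.
U : ∀ {m} → Vec ℕ m → Set
U = All Fin

-- Subsets of the finite set U are Boolean characteristic functions,
-- compared pointwise.
SubsetU : ∀ {m} → Vec ℕ m → Set
SubsetU ns = U ns → Bool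

infix 4 _∈ᵁ_ _≐ᵁ_

_∈ᵁ_ : ∀ {m} {ns : Vec ℕ m} → U ns → SubsetU ns → Set
x ∈ᵁ S = T (S x)

_≐ᵁ_ : ∀ {m} {ns : Vec ℕ m} → SubsetU ns → SubsetU ns → Set
S ≐ᵁ S′ = ∀ x → S x ≡ S′ x

tuples : ∀ {m} (ns : Vec ℕ m) → List (U ns)
tuples []       = [] ∷ []
tuples (n ∷ ns) = cartesianProductWith _∷_ (allFin n) (tuples ns)

-- The number of x in U satisfying a decidable predicate.
# : ∀ {m} {ns : Vec ℕ m} {Q : Pred (U ns) 0ℓ} → Decidable Q → ℕ
# {ns = ns} Q? = length (filter Q? (tuples ns))

-- The blocks of a partition are indexed by Fin size; the order of this
-- indexing plays no role.
record Partition (n : ℕ) : Set where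
  field
    size     : ℕ
    block    : Fin size → Subset n
    nonempty : ∀ b → Nonempty (block b)
    cover    : ∀ x → ∃! _≡_ (λ b → x ∈ block b)

  blockOf : Fin n → Fin size
  blockOf x = proj₁ (cover x)

open Partition public

GenPartition : ∀ {m} → Vec ℕ m → Set
GenPartition = All Partition

module _ {m : ℕ} {ns : Vec ℕ m} (Λ : GenPartition ns) where

  -- A choice of one block Pⁱ ∈ αᵢ for each i, that is, an element of M(Λ);
  -- it names the box P¹ × ⋯ × Pᵐ.
  Box : Set
  Box = ∀ i → Fin (size (lookup Λ i))

  InBox : Box → Pred (U ns) 0ℓ
  InBox P x = ∀ i → lookup x i ∈ block (lookup Λ i) (P i)

  inBox? : ∀ P → Decidable (InBox P)
  inBox? P x = all? (λ i → lookup x i ∈? block (lookup Λ i) (P i))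

  boxOf : U ns → Box
  boxOf x i = blockOf (lookup Λ i) (lookup x i)

  Shattered : SubsetU ns → Set
  Shattered S = ∀ P → ∃ λ x → x ∈ᵁ S × InBox P x

  -- W = (W₁, …, Wₘ) gives the factors of a copy W₁ × ⋯ × Wₘ of M(Λ).
  IsCopy : All Subset ns → Set
  IsCopy W = ∀ i (b : Fin (size (lookup Λ i))) →
    ∃! _≡_ (λ w → w ∈ lookup W i × w ∈ block (lookup Λ i) b)

  StronglyShattered : SubsetU ns → Set
  StronglyShattered S = ∃ λ (W : All Subset ns) → IsCopy W ×
    (∀ (x : U ns) → (∀ i → lookup x i ∈ lookup W i) → x ∈ᵁ S)

  InSupport : Fin m → Set
  InSupport i = ∃ λ b → ∣ block (lookup Λ i) b ∣ ≢ 1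

Ample : ∀ {m} {ns : Vec ℕ m} → SubsetU ns → Set
Ample {ns = ns} S = ∀ (Λ : GenPartition ns) → Shattered Λ S → StronglyShattered Λ S

-- A one-dimensional minor-subproduct M(Λ), represented by Λ.
record OneDim {m : ℕ} (ns : Vec ℕ m) : Set where
  field
    Λ      : GenPartition ns
    oneDim : ∃! _≡_ (InSupport Λ)

  dir : Fin m
  dir = proj₁ oneDim

open OneDim public using (dir)

-- Elements of one box B are distinguished by their coordinate in direction i.
-- So x ∈ B is among the ∣ S ∩ B ∣ elements of B with the smallest i-th
-- coordinates iff fewer than ∣ S ∩ B ∣ elements of B have a smaller i-th
-- coordinate than x.
infixl 8 _[_↓] _[_↓*]

_[_↓] : ∀ {m} {ns : Vec ℕ m} → SubsetU ns → OneDim ns → SubsetU ns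
(S [ M ↓]) x = ⌊ # smaller? <? # S∩B? ⌋
  where
  open OneDim M using (Λ) renaming (dir to i)

  B = boxOf Λ x

  S∩B? : Decidable (λ y → y ∈ᵁ S × InBox Λ B y)
  S∩B? y = T? (S y) ×-dec inBox? Λ B y

  smaller? : Decidable (λ y → InBox Λ B y × lookup y i <ᶠ lookup x i)
  smaller? y = inBox? Λ B y ×-dec (lookup y i <ᶠ? lookup x i)

_[_↓*] : ∀ {m} {ns : Vec ℕ m} → SubsetU ns → List (OneDim ns) → SubsetU ns
S [ Ms ↓*] = foldl _[_↓] S Ms

SerialPushDownsCommute : ∀ {m} {ns : Vec ℕ m} → SubsetU ns → Set
SerialPushDownsCommute {ns = ns} S =
  ∀ (Ms Ms′ : List (OneDim ns)) → Unique (map dir Ms) → Ms ↭ Ms′ →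
  S [ Ms ↓*] ≐ᵁ S [ Ms′ ↓*]

{-# OPTIONS --safe #-}

-- A push down along M replaces, in direction i, every line x[i ≔ ·] by its image under a monotone
-- Boolean function of the line that depends only on the i-th coordinate.
--
-- Ample sets are closed under all such transformations: if the transform of S meets every box, let X be
-- the set of values u whose slice S_u meets every box of the other coordinates.  Merging the complement
-- of X into one block, and then absorbing it into the block of an element of X, ampleness first shows
-- that X satisfies the functions in question and then gives a copy with full i-th factor X.  Hence only
-- two push downs have to be exchanged, and for these ampleness turns "every column has an element
-- outside X" into "some row outside X meets all columns".
--
-- Conversely, pushing down along a block P in direction i, and reading the result at the least
-- (greatest) element of P, is the quantifier ∃ (∀) over u ∈ P.  So commutation lets quantifiers over
-- subsets of distinct coordinates be exchanged, and a copy is built one coordinate at a time: the union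
-- of the slices over a block of the first coordinate contains a copy by induction, hence so does a single
-- slice S_w; then the intersection of the chosen slices S_w again meets every box.
module Submission where

open import Defs
open import Data.Bool.Base using (Bool; true; false; T; if_then_else_)
open import Data.Bool.Properties using (T?)
open import Data.Empty using (⊥; ⊥-elim)
open import Data.Fin.Base using (Fin; zero; suc; toℕ) renaming (_<_ to _<ᶠ_)
open import Data.Fin.Properties using (_≟_; suc-injective; any?; all?; toℕ-injective) renaming (_<?_ to _<ᶠ?_)
import Data.Fin.Properties as Fin
open import Data.Fin.Subset using (Subset; _∈_; ∣_∣; ⁅_⁆)
open import Data.Fin.Subset.Properties
  using (_∈?_; p⊆q⇒∣p∣≤∣q∣; p⊂q⇒∣p∣<∣q∣; x∈⁅x⁆; x∈⁅y⁆⇒x≡y; ∣⁅x⁆∣≡1; ∣p∣≤∣x∷p∣)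
open import Data.List.Base as List using (List; []; _∷_; _++_; map; length; filter; cartesianProductWith; allFin)
open import Data.List.Membership.Propositional using () renaming (_∈_ to _∈ˡ_; _∉_ to _∉ˡ_)
open import Data.List.Membership.Propositional.Properties using (∈-allFin)
open import Data.List.Properties using (filter-++; length-++; filter-none; foldl-++; map-++)
open import Data.List.Relation.Binary.Permutation.Propositional using (_↭_; ↭⇒↭ₛ)
open import Data.List.Relation.Binary.Permutation.Propositional.Properties
  using (++-comm; ++⁺ˡ)
  renaming (map⁺ to ↭-map⁺)
import Data.List.Relation.Binary.Permutation.Setoid.Properties as ↭ₛ
open import Data.List.Relation.Unary.All using ([]; _∷_; universal) renaming (lookup to lookupˡ)
open import Data.List.Relation.Unary.All.Properties using () renaming (map⁺ to Allˡ-map⁺)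
open import Data.List.Relation.Unary.AllPairs using ([]; _∷_)
open import Data.List.Relation.Unary.Any using (here; there)
open import Data.List.Relation.Unary.Unique.Propositional using (Unique)
open import Data.List.Relation.Unary.Unique.Propositional.Properties
  using (allFin⁺)
  renaming (map⁺ to Unique-map⁺)
open import Data.Nat.Base using (ℕ; zero; suc; NonZero; _+_; _≤_; _<_; z≤n; s≤s; s≤s⁻¹)
open import Data.Nat.Properties
  using (_<?_; ≤-refl; ≤-trans; ≤-<-trans; <-≤-trans; ≤-antisym; +-identityʳ; <-irrefl)
  renaming (_≟_ to _≟ℕ_)
import Data.Nat.Properties as ℕ
open import Data.Product using (∃; ∃₂; _×_; _,_; proj₁; proj₂)
open import Data.Vec.Base as Vec using (Vec; []; _∷_; tabulate)
open import Data.Vec.Properties using (lookup∘tabulate; []=⇒lookup; lookup⇒[]=)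
open import Data.Vec.Relation.Unary.All as All using (All; []; _∷_)
open import Data.Vec.Relation.Unary.All.Properties using (lookup⁻) renaming (lookup⁺ to lookup)
open import Function.Base using (_∘_; id)
open import Function.Bundles using (_⇔_; mk⇔; Equivalence)
open import Level using (0ℓ)
open import Relation.Binary.Definitions using (tri<; tri≈; tri>)
open import Relation.Binary.PropositionalEquality
  using (_≡_; _≢_; refl; sym; trans; cong; cong₂; subst; setoid; module ≡-Reasoning)
open import Relation.Nullary.Decidable
  using (Dec; yes; no; does; ⌊_⌋; _×-dec_; _→-dec_; ¬?; toWitness; fromWitness; map′; decidable-stable)
open import Relation.Nullary.Negation using (¬_)
open import Relation.Unary using (Pred; Decidable)

open Equivalence using (to; from)

private
  variable
    m n : ℕ
    ns : Vec ℕ m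

T-ext : ∀ {a b} → (T a → T b) → (T b → T a) → a ≡ b
T-ext {false} {false} f g = refl
T-ext {false} {true}  f g = ⊥-elim (g _)
T-ext {true}  {false} f g = ⊥-elim (f _)
T-ext {true}  {true}  f g = refl

-- Tuples

lookup-ext : {x y : U ns} → (∀ j → lookup x j ≡ lookup y j) → x ≡ y
lookup-ext {x = []}     {[]}     eq = refl
lookup-ext {x = u ∷ xs} {v ∷ ys} eq = cong₂ _∷_ (eq zero) (lookup-ext (eq ∘ suc))

lookup∘lookup⁻ : ∀ {m} (ns : Vec ℕ m) (P : Pred ℕ 0ℓ) (f : ∀ j → P (Vec.lookup ns j)) j →
                 lookup (lookup⁻ {P = P} {xs = ns} f) j ≡ f j
lookup∘lookup⁻ (n ∷ ns) P f zero    = refl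
lookup∘lookup⁻ (n ∷ ns) P f (suc j) = lookup∘lookup⁻ ns P (f ∘ suc) j

infixl 9 _[_≔_]

_[_≔_] : U ns → ∀ i → Fin (Vec.lookup ns i) → U ns
(_ ∷ xs) [ zero  ≔ u ] = u ∷ xs
(x ∷ xs) [ suc i ≔ u ] = x ∷ xs [ i ≔ u ]

lookup-≔-same : ∀ (x : U ns) i u → lookup (x [ i ≔ u ]) i ≡ u
lookup-≔-same (_ ∷ _)  zero    u = refl
lookup-≔-same (_ ∷ xs) (suc i) u = lookup-≔-same xs i u

lookup-≔-other : ∀ (x : U ns) {i j} u → j ≢ i → lookup (x [ i ≔ u ]) j ≡ lookup x j
lookup-≔-other (_ ∷ _)  {zero}  {zero}  u j≢i = ⊥-elim (j≢i refl)
lookup-≔-other (_ ∷ _)  {zero}  {suc j} u j≢i = refl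
lookup-≔-other (_ ∷ _)  {suc i} {zero}  u j≢i = refl
lookup-≔-other (_ ∷ xs) {suc i} {suc j} u j≢i = lookup-≔-other xs u (j≢i ∘ cong suc)

≔-elim : ∀ (x : U ns) i u (P : ∀ j → Fin (Vec.lookup ns j) → Set) →
         P i u → (∀ j → j ≢ i → P j (lookup x j)) → ∀ j → P j (lookup (x [ i ≔ u ]) j)
≔-elim x i u P Pi Pj j with j ≟ i
... | yes refl = subst (P j) (sym (lookup-≔-same x j u)) Pi
... | no  j≢i  = subst (P j) (sym (lookup-≔-other x u j≢i)) (Pj j j≢i)

allᵁ? : {P : Pred (U ns) 0ℓ} → Decidable P → Dec (∀ x → P x)
allᵁ? {ns = []}     P? = map′ (λ { p [] → p }) (λ p → p []) (P? [])
allᵁ? {ns = n ∷ ns} P? =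
  map′ (λ { p (u ∷ x) → p u x }) (λ p u x → p (u ∷ x)) (all? λ u → allᵁ? λ x → P? (u ∷ x))

anyᵁ? : {P : Pred (U ns) 0ℓ} → Decidable P → Dec (∃ P)
anyᵁ? {ns = []}     P? = map′ (λ p → [] , p) (λ { ([] , p) → p }) (P? [])
anyᵁ? {ns = n ∷ ns} P? =
  map′ (λ { (u , x , p) → u ∷ x , p }) (λ { (u ∷ x , p) → u , x , p }) (any? λ u → anyᵁ? λ x → P? (u ∷ x))

-- Counting

⟨_⟩ : {P : Pred (Fin n) 0ℓ} → Decidable P → Subset n
⟨ P? ⟩ = tabulate λ u → ⌊ P? u ⌋

module _ {P : Pred (Fin n) 0ℓ} (P? : Decidable P) where

  ∈⟨⟩⁺ : ∀ {u} → P u → u ∈ ⟨ P? ⟩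
  ∈⟨⟩⁺ {u} p with P? u in eq
  ... | yes _ = lookup⇒[]= u _ (trans (lookup∘tabulate _ u) (cong ⌊_⌋ eq))
  ... | no ¬p = ⊥-elim (¬p p)

  ∈⟨⟩⁻ : ∀ {u} → u ∈ ⟨ P? ⟩ → P u
  ∈⟨⟩⁻ {u} u∈ with P? u in eq
  ... | yes p = p
  ... | no  _ with () ← trans (sym ([]=⇒lookup u∈)) (trans (lookup∘tabulate _ u) (cong ⌊_⌋ eq))

card : {P : Pred (Fin n) 0ℓ} → Decidable P → ℕ
card P? = ∣ ⟨ P? ⟩ ∣

module _ {P Q : Pred (Fin n) 0ℓ} (P? : Decidable P) (Q? : Decidable Q) where

  card-mono : (∀ {u} → P u → Q u) → card P? ≤ card Q?
  card-mono f = p⊆q⇒∣p∣≤∣q∣ (∈⟨⟩⁺ Q? ∘ f ∘ ∈⟨⟩⁻ P?)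

  card-strict : (∀ {u} → P u → Q u) → ∃ (λ u → Q u × ¬ P u) → card P? < card Q?
  card-strict f (u , q , ¬p) = p⊂q⇒∣p∣<∣q∣ (∈⟨⟩⁺ Q? ∘ f ∘ ∈⟨⟩⁻ P? , u , ∈⟨⟩⁺ Q? q , ¬p ∘ ∈⟨⟩⁻ P?)

card-cong : {P Q : Pred (Fin n) 0ℓ} (P? : Decidable P) (Q? : Decidable Q) →
            (∀ {u} → P u → Q u) → (∀ {u} → Q u → P u) → card P? ≡ card Q?
card-cong P? Q? f g = ≤-antisym (card-mono P? Q? f) (card-mono Q? P? g)

∑ : (Fin n → ℕ) → ℕ
∑ {zero}  g = 0
∑ {suc n} g = g zero + ∑ (g ∘ suc)

∑-cong : {g h : Fin n → ℕ} → (∀ u → g u ≡ h u) → ∑ g ≡ ∑ h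
∑-cong {zero}  eq = refl
∑-cong {suc n} eq = cong₂ _+_ (eq zero) (∑-cong (eq ∘ suc))

∑-zero : {g : Fin n → ℕ} → (∀ u → g u ≡ 0) → ∑ g ≡ 0
∑-zero {zero}  eq = refl
∑-zero {suc n} eq rewrite eq zero = ∑-zero (eq ∘ suc)

∑-single : {g : Fin n → ℕ} (v : Fin n) → (∀ u → u ≢ v → g u ≡ 0) → ∑ g ≡ g v
∑-single {suc n} {g} zero eq =
  trans (cong (g zero +_) (∑-zero λ u → eq (suc u) λ ())) (+-identityʳ _)
∑-single {suc n} {g} (suc v) eq rewrite eq zero (λ ()) =
  ∑-single v λ u u≢v → eq (suc u) (u≢v ∘ suc-injective)

indicator : Bool → ℕ
indicator b = if b then 1 else 0

∣tabulate∣ : (b : Fin n → Bool) → ∣ tabulate b ∣ ≡ ∑ (indicator ∘ b)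
∣tabulate∣ {zero}  b = refl
∣tabulate∣ {suc n} b with b zero
... | true  = cong suc (∣tabulate∣ (b ∘ suc))
... | false = ∣tabulate∣ (b ∘ suc)

card-empty : {P : Pred (Fin n) 0ℓ} (P? : Decidable P) → (∀ u → ¬ P u) → card P? ≡ 0
card-empty P? ¬P = trans (∣tabulate∣ λ u → ⌊ P? u ⌋) (∑-zero λ u → lemma (P? u) (¬P u))
  where
  lemma : ∀ {A : Set} (a? : Dec A) → ¬ A → indicator ⌊ a? ⌋ ≡ 0
  lemma (yes a) ¬a = ⊥-elim (¬a a)
  lemma (no _)  ¬a = refl

card-positive : {P : Pred (Fin n) 0ℓ} (P? : Decidable P) → 0 < card P? → ∃ P
card-positive P? 0<c with any? P?
... | yes w = w
... | no ¬w = ⊥-elim (<-irrefl (sym (card-empty P? λ u p → ¬w (u , p))) 0<c)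

length-filter-map : ∀ {A B : Set} {Q : Pred B 0ℓ} (Q? : Decidable Q) (f : A → B) xs →
  length (filter Q? (List.map f xs)) ≡ length (filter (λ a → Q? (f a)) xs)
length-filter-map Q? f []       = refl
length-filter-map Q? f (x ∷ xs) with does (Q? (f x))
... | true  = cong suc (length-filter-map Q? f xs)
... | false = length-filter-map Q? f xs

#-cons : {Q : Pred (U (n ∷ ns)) 0ℓ} (Q? : Decidable Q) → # Q? ≡ ∑ λ u → # λ x → Q? (u ∷ x)
#-cons {n} {ns = ns} Q? = go id
  where
  -- `allFin n` is the tabulation of `id`, whose tail is a tabulation of `suc`; hence the induction
  -- over an arbitrary `g`.
  go : ∀ {k} (g : Fin k → Fin n) →
       length (filter Q? (cartesianProductWith _∷_ (List.tabulate g) (tuples ns))) ≡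
       ∑ λ u → # λ x → Q? (g u ∷ x)
  go {zero}  g = refl
  go {suc k} g = begin
    length (filter Q? (List.map (g zero ∷_) (tuples ns) List.++ rest))
      ≡⟨ cong length (filter-++ Q? (List.map (g zero ∷_) (tuples ns)) rest) ⟩
    length (filter Q? (List.map (g zero ∷_) (tuples ns)) List.++ filter Q? rest)
      ≡⟨ length-++ (filter Q? (List.map (g zero ∷_) (tuples ns))) ⟩
    length (filter Q? (List.map (g zero ∷_) (tuples ns))) + length (filter Q? rest)
      ≡⟨ cong₂ _+_ (length-filter-map Q? (g zero ∷_) (tuples ns)) (go (g ∘ suc)) ⟩
    ∑ (λ u → # λ x → Q? (g u ∷ x)) ∎
    where
    open ≡-Reasoning
    rest = cartesianProductWith _∷_ (List.tabulate (g ∘ suc)) (tuples ns)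

#-empty : {Q : Pred (U ns) 0ℓ} (Q? : Decidable Q) → (∀ y → ¬ Q y) → # Q? ≡ 0
#-empty {ns = ns} Q? ¬Q = cong length (filter-none Q? (universal ¬Q (tuples ns)))

#-point : {Q : Pred (U ns) 0ℓ} (Q? : Decidable Q) (x : U ns) → (∀ y → Q y → y ≡ x) →
          # Q? ≡ indicator ⌊ Q? x ⌋
#-point Q? [] _ with Q? []
... | yes _ = refl
... | no _  = refl
#-point Q? (u ∷ x) h = trans (#-cons Q?) (trans
  (∑-single u λ v v≢u → #-empty _ λ y q → v≢u (cong (λ z → lookup z zero) (h (v ∷ y) q)))
  (#-point (λ y → Q? (u ∷ y)) x λ y q → lookup-ext λ j → cong (λ z → lookup z (suc j)) (h (u ∷ y) q)))

#-line : {Q : Pred (U ns) 0ℓ} (Q? : Decidable Q) (x : U ns) (i : Fin _) →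
         (∀ y → Q y → ∀ j → j ≢ i → lookup y j ≡ lookup x j) →
         # Q? ≡ card λ u → Q? (x [ i ≔ u ])
#-line Q? (v ∷ x) zero h = trans (#-cons Q?) (trans
  (∑-cong λ u → #-point (λ y → Q? (u ∷ y)) x λ y q → lookup-ext λ j → h (u ∷ y) q (suc j) λ ())
  (sym (∣tabulate∣ λ u → ⌊ Q? (u ∷ x) ⌋)))
#-line Q? (v ∷ x) (suc i) h = trans (#-cons Q?) (trans
  (∑-single v λ u u≢v → #-empty _ λ y q → u≢v (h (u ∷ y) q zero λ ()))
  (#-line (λ y → Q? (v ∷ y)) x i λ y q j j≢i → h (v ∷ y) q (suc j) (j≢i ∘ suc-injective)))

∣p∣≡1⇒unique : ∀ {p : Subset n} {x y} → ∣ p ∣ ≡ 1 → x ∈ p → y ∈ p → x ≡ y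
∣p∣≡1⇒unique {p = p} {x} {y} eq x∈p y∈p with x ≟ y
... | yes x≡y = x≡y
... | no  x≢y = ⊥-elim (<-irrefl (trans (∣⁅x⁆∣≡1 x) (sym eq))
  (p⊂q⇒∣p∣<∣q∣ ((λ z∈ → subst (_∈ p) (sym (x∈⁅y⁆⇒x≡y x z∈)) x∈p) , y , y∈p ,
    λ y∈ → x≢y (sym (x∈⁅y⁆⇒x≡y x y∈)))))

-- Blocks, and push downs read along a line

∈-blockOf : ∀ (α : Partition n) u → u ∈ block α (blockOf α u)
∈-blockOf α u = proj₁ (proj₂ (cover α u))

∈⇒blockOf : ∀ (α : Partition n) {u b} → u ∈ block α b → blockOf α u ≡ b
∈⇒blockOf α {u} = proj₂ (proj₂ (cover α u))

blockOf⇒∈ : ∀ (α : Partition n) {u b} → blockOf α u ≡ b → u ∈ block α b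
blockOf⇒∈ α {u} refl = ∈-blockOf α u

module _ (α : Partition n) (v : Fin n) where

  below? : Decidable λ u → u ∈ block α (blockOf α v) × u <ᶠ v
  below? u = (u ∈? block α (blockOf α v)) ×-dec (u <ᶠ? v)

  within? : (A : Fin n → Bool) → Decidable λ u → T (A u) × u ∈ block α (blockOf α v)
  within? A u = T? (A u) ×-dec (u ∈? block α (blockOf α v))

  -- The condition defining the push down, on one line: `A` is the trace of the set on the line and
  -- `v` the coordinate of the point in question.
  above : (Fin n → Bool) → Bool
  above A = ⌊ card below? <? card (within? A) ⌋

  above-mono : ∀ {A B} → (∀ u → T (A u) → T (B u)) → T (above A) → T (above B)
  above-mono {A} {B} A⊆B a = fromWitness
    (<-≤-trans (toWitness a) (card-mono (within? A) (within? B) λ { (a , u∈) → A⊆B _ a , u∈ }))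

  above-nonempty : ∀ {A} → T (above A) → ∃ λ u → T (A u) × u ∈ block α (blockOf α v)
  above-nonempty {A} a = card-positive (within? A) (≤-<-trans z≤n (toWitness a))

boxOf-InBox : ∀ {m} {ns : Vec ℕ m} (Λ : GenPartition ns) x → InBox Λ (boxOf Λ x) x
boxOf-InBox Λ x j = ∈-blockOf (lookup Λ j) (lookup x j)

singletonBlocks : ∀ {m} {ns : Vec ℕ m} (M : OneDim ns) {j} → j ≢ dir M →
                  ∀ b → ∣ block (lookup (OneDim.Λ M) j) b ∣ ≡ 1
singletonBlocks M {j} j≢i b with ∣ block (lookup (OneDim.Λ M) j) b ∣ ≟ℕ 1
... | yes eq = eq
... | no neq = ⊥-elim (j≢i (sym (proj₂ (proj₂ (OneDim.oneDim M)) (b , neq))))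

pushDown : ∀ {m} {ns : Vec ℕ m} (S : SubsetU ns) (M : OneDim ns) x →
  (S [ M ↓]) x ≡ above (lookup (OneDim.Λ M) (dir M)) (lookup x (dir M)) (λ u → S (x [ dir M ≔ u ]))
pushDown S M x = cong₂ (λ a b → ⌊ a <? b ⌋)
  (trans (#-line _ x i λ y (y∈ , _) j j≢i → unique y y∈ j≢i)
    (card-cong _ (below? α v)
      (λ {u} (y∈ , lt) → subst (_∈ B) (same u) (y∈ i) , subst (_<ᶠ v) (same u) lt)
      (λ {u} (u∈ , lt) → inBox u∈ , subst (_<ᶠ v) (sym (same u)) lt)))
  (trans (#-line _ x i λ y (_ , y∈) j j≢i → unique y y∈ j≢i)
    (card-cong _ (within? α v _)
      (λ {u} (s , y∈) → s , subst (_∈ B) (same u) (y∈ i))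
      (λ {u} (s , u∈) → s , inBox u∈)))
  where
  open OneDim M using (Λ) renaming (dir to i)
  α = lookup Λ i
  v = lookup x i
  B = block α (blockOf α v)

  same : ∀ u → lookup (x [ i ≔ u ]) i ≡ u
  same = lookup-≔-same x i

  unique : ∀ y → InBox Λ (boxOf Λ x) y → ∀ {j} → j ≢ i → lookup y j ≡ lookup x j
  unique y y∈ {j} j≢i = ∣p∣≡1⇒unique (singletonBlocks M j≢i _) (y∈ j) (boxOf-InBox Λ x j)

  inBox : ∀ {u} → u ∈ B → InBox Λ (boxOf Λ x) (x [ i ≔ u ])
  inBox {u} u∈ = ≔-elim x i u (λ j w → w ∈ block (lookup Λ j) (boxOf Λ x j)) u∈
    λ j _ → boxOf-InBox Λ x j

-- Partitions from labellings

-- Generalized partitions are handled as labellings, whose fibres are the blocks: changing one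
-- component or gluing blocks then requires no re-indexing.
Labelling : Vec ℕ m → Set
Labelling {m} ns = (j : Fin m) → Fin (Vec.lookup ns j) → ℕ

-- The quotient of `Fin n` by the kernel of `κ`, with classes numbered consecutively as `Partition`
-- demands.
record Image (κ : Fin n → ℕ) : Set where
  field
    classCount : ℕ
    index      : Fin n → Fin classCount
    surjective : ∀ b → ∃ λ x → index x ≡ b
    sound      : ∀ x y → index x ≡ index y → κ x ≡ κ y
    complete   : ∀ x y → κ x ≡ κ y → index x ≡ index y

image : ∀ {n} (κ : Fin n → ℕ) → Image κ
image {zero}  κ = record
  { classCount = 0 ; index = λ () ; surjective = λ () ; sound = λ () ; complete = λ () }
image {suc n} κ with any? (λ y → κ zero ≟ℕ κ (suc y)) | image (κ ∘ suc)
... | yes (y , eq) | record { classCount = s ; index = g ; surjective = sur ; sound = snd ; complete = cmp } = record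
  { classCount = s
  ; index      = λ { zero → g y ; (suc x) → g x }
  ; surjective = λ b → suc (proj₁ (sur b)) , proj₂ (sur b)
  ; sound      = λ { zero    zero    _ → refl
                   ; zero    (suc z) e → trans eq (snd y z e)
                   ; (suc x) zero    e → trans (snd x y e) (sym eq)
                   ; (suc x) (suc z) e → snd x z e }
  ; complete   = λ { zero    zero    _ → refl
                   ; zero    (suc z) e → cmp y z (trans (sym eq) e)
                   ; (suc x) zero    e → cmp x y (trans e eq)
                   ; (suc x) (suc z) e → cmp x z e }
  }
... | no new | record { classCount = s ; index = g ; surjective = sur ; sound = snd ; complete = cmp } = record
  { classCount = suc s
  ; index      = λ { zero → zero ; (suc x) → suc (g x) }
  ; surjective = λ { zero → zero , refl ; (suc b) → suc (proj₁ (sur b)) , cong suc (proj₂ (sur b)) }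
  ; sound      = λ { zero    zero    _ → refl
                   ; (suc x) (suc z) e → snd x z (suc-injective e) }
  ; complete   = λ { zero    zero    _ → refl
                   ; zero    (suc z) e → ⊥-elim (new (z , e))
                   ; (suc x) zero    e → ⊥-elim (new (x , sym e))
                   ; (suc x) (suc z) e → cong suc (cmp x z e) }
  }

classes : (Fin n → ℕ) → Partition n
classes κ = record
  { size     = classCount
  ; block    = λ b → ⟨ (λ x → index x ≟ b) ⟩
  ; nonempty = λ b → proj₁ (surjective b) , ∈⟨⟩⁺ (λ x → index x ≟ b) (proj₂ (surjective b))
  ; cover    = λ x → index x , ∈⟨⟩⁺ (λ z → index z ≟ index x) refl ,
                     λ {b} x∈ → ∈⟨⟩⁻ (λ z → index z ≟ b) x∈
  }
  where open Image (image κ)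

classes-sound : ∀ (κ : Fin n → ℕ) {x y} → blockOf (classes κ) x ≡ blockOf (classes κ) y → κ x ≡ κ y
classes-sound κ = Image.sound (image κ) _ _

classes-complete : ∀ (κ : Fin n → ℕ) {x y} → κ x ≡ κ y → blockOf (classes κ) x ≡ blockOf (classes κ) y
classes-complete κ = Image.complete (image κ) _ _

-- Counterpart of `Shattered`. A box is named by any point `z` in it, so boxes are nonempty by
-- construction.
Meets : Labelling ns → SubsetU ns → Set
Meets {ns = ns} κ S = ∀ (z : U ns) → ∃ λ y → T (S y) × ∀ j → κ j (lookup y j) ≡ κ j (lookup z j)

-- Unlike in `IsCopy`, `W` may contain several elements of a class. This slack lets `transform-copy`
-- take a set cut out by a Boolean function as a factor; `labelAmple⇒ample` thins it out.
record Copy {m} {ns : Vec ℕ m} (κ : Labelling ns) (S : SubsetU ns) : Set where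
  field
    W    : ∀ j → Fin (Vec.lookup ns j) → Bool
    pick : ∀ j v → ∃ λ w → T (W j w) × κ j w ≡ κ j v
    W⊆S  : ∀ x → (∀ j → T (W j (lookup x j))) → T (S x)

  meets : Meets κ S
  meets z = y , W⊆S y (λ j → subst (T ∘ W j) (sym (eq j)) (proj₁ (proj₂ (w j)))) ,
            λ j → trans (cong (κ j) (eq j)) (proj₂ (proj₂ (w j)))
    where
    w : ∀ j → ∃ λ v → T (W j v) × κ j v ≡ κ j (lookup z j)
    w j = pick j (lookup z j)
    y : U ns
    y = lookup⁻ (λ j → proj₁ (w j))
    eq : ∀ j → lookup y j ≡ proj₁ (w j)
    eq = lookup∘lookup⁻ ns Fin (λ j → proj₁ (w j))

LabelAmple : SubsetU ns → Set
LabelAmple {ns = ns} S = ∀ κ → Meets κ S → Copy κ S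

ample⇒labelAmple : {S : SubsetU ns} → Ample S → LabelAmple S
ample⇒labelAmple {ns = ns} {S} ample κ meets = record
  { W    = λ j w → ⌊ w ∈? lookup W j ⌋
  ; pick = λ j v → let w , (w∈W , w∈b) , _ = isCopy j (blockOf (lookup Λ j) v) in
                   w , fromWitness w∈W , sound j (∈⇒blockOf (lookup Λ j) w∈b)
  ; W⊆S  = λ x x∈ → W⊆S x (λ j → toWitness (x∈ j))
  }
  where
  Λ : GenPartition ns
  Λ = lookup⁻ (λ j → classes (κ j))

  Λ-classes : ∀ j → lookup Λ j ≡ classes (κ j)
  Λ-classes = lookup∘lookup⁻ ns Partition (λ j → classes (κ j))

  sound : ∀ j {u v} → blockOf (lookup Λ j) u ≡ blockOf (lookup Λ j) v → κ j u ≡ κ j v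
  sound j rewrite Λ-classes j = classes-sound (κ j)

  complete : ∀ j {u v} → κ j u ≡ κ j v → blockOf (lookup Λ j) u ≡ blockOf (lookup Λ j) v
  complete j rewrite Λ-classes j = classes-complete (κ j)

  shattered : Shattered Λ S
  shattered P = y , y∈S , λ j → blockOf⇒∈ (lookup Λ j) (trans (complete j (y~z j)) (z∈P j))
    where
    rep : ∀ j → ∃ λ (v : Fin (Vec.lookup ns j)) → v ∈ block (lookup Λ j) (P j)
    rep j = nonempty (lookup Λ j) (P j)
    z : U ns
    z = lookup⁻ (λ j → proj₁ (rep j))
    z∈P : ∀ j → blockOf (lookup Λ j) (lookup z j) ≡ P j
    z∈P j = trans (cong (blockOf (lookup Λ j)) (lookup∘lookup⁻ ns Fin (λ j → proj₁ (rep j)) j))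
                  (∈⇒blockOf (lookup Λ j) (proj₂ (rep j)))
    y = proj₁ (meets z)
    y∈S = proj₁ (proj₂ (meets z))
    y~z = proj₂ (proj₂ (meets z))

  strong = ample Λ shattered
  W = proj₁ strong
  isCopy = proj₁ (proj₂ strong)
  W⊆S = proj₂ (proj₂ strong)

labelAmple⇒ample : {S : SubsetU ns} → LabelAmple S → Ample S
labelAmple⇒ample {ns = ns} {S} ample Λ shattered = V , isCopy , V⊆S
  where
  κ : Labelling ns
  κ j v = toℕ (blockOf (lookup Λ j) v)

  copy : Copy κ S
  copy = ample κ λ z → let y , y∈S , y∈ = shattered (boxOf Λ z) in
    y , y∈S , λ j → cong toℕ (∈⇒blockOf (lookup Λ j) (y∈ j))
  open Copy copy

  rep : ∀ j → Fin (size (lookup Λ j)) → Fin (Vec.lookup ns j)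
  rep j b = proj₁ (pick j (proj₁ (nonempty (lookup Λ j) b)))

  rep-block : ∀ j b → blockOf (lookup Λ j) (rep j b) ≡ b
  rep-block j b = trans (toℕ-injective (proj₂ (proj₂ (pick j _))))
    (∈⇒blockOf (lookup Λ j) (proj₂ (nonempty (lookup Λ j) b)))

  -- Of the possibly several elements of `W` in a block, only the one determined by the block number
  -- is kept, which yields the uniqueness in `IsCopy`.
  IsRep : ∀ j → Pred (Fin (Vec.lookup ns j)) 0ℓ
  IsRep j v = v ≡ rep j (blockOf (lookup Λ j) v)

  isRep? : ∀ j → Decidable (IsRep j)
  isRep? j v = v ≟ rep j (blockOf (lookup Λ j) v)

  V : All Subset ns
  V = lookup⁻ (λ j → ⟨ isRep? j ⟩)

  V-isRep : ∀ j → lookup V j ≡ ⟨ isRep? j ⟩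
  V-isRep = lookup∘lookup⁻ ns Subset (λ j → ⟨ isRep? j ⟩)

  ∈V⁻ : ∀ j {v} → v ∈ lookup V j → IsRep j v
  ∈V⁻ j rewrite V-isRep j = ∈⟨⟩⁻ (isRep? j)

  ∈V⁺ : ∀ j {v} → IsRep j v → v ∈ lookup V j
  ∈V⁺ j rewrite V-isRep j = ∈⟨⟩⁺ (isRep? j)

  isCopy : IsCopy Λ V
  isCopy j b = rep j b ,
    (∈V⁺ j (cong (rep j) (sym (rep-block j b))) , blockOf⇒∈ (lookup Λ j) (rep-block j b)) ,
    λ {v} (v∈V , v∈b) → sym (trans (∈V⁻ j v∈V) (cong (rep j) (∈⇒blockOf (lookup Λ j) v∈b)))

  V⊆S : ∀ x → (∀ j → lookup x j ∈ lookup V j) → x ∈ᵁ S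
  V⊆S x x∈V = W⊆S x λ j → subst (T ∘ W j) (sym (∈V⁻ j (x∈V j))) (proj₁ (proj₂ (pick j _)))

labelAmple-resp-≐ : {S S′ : SubsetU ns} → S ≐ᵁ S′ → LabelAmple S → LabelAmple S′
labelAmple-resp-≐ {S = S} eq ample κ meets = record
  { W = W ; pick = pick ; W⊆S = λ x x∈ → subst T (eq x) (W⊆S x x∈) }
  where
  copy : Copy κ S
  copy = ample κ λ z → let y , y∈ , y~z = meets z in y , subst T (sym (eq y)) y∈ , y~z
  open Copy copy

-- Monotone transformations along one coordinate

-- `strict` says that `f` is false on the empty set; it supplies the good value `x₀` and, in
-- `exchange`, the column `v₀∈Y`. Monotonicity in both directions gives `cong-≗` without function
-- extensionality.
record Monotone (f : (Fin n → Bool) → Bool) : Set where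
  field
    mono   : ∀ {A B} → (∀ u → T (A u) → T (B u)) → T (f A) → T (f B)
    strict : ∀ {A} → T (f A) → ∃ λ u → T (A u)

  cong-≗ : ∀ {A B} → (∀ u → A u ≡ B u) → f A ≡ f B
  cong-≗ eq = T-ext (mono λ u → subst T (eq u)) (mono λ u → subst T (sym (eq u)))

open Monotone

above-monotone : ∀ (α : Partition n) v → Monotone (above α v)
above-monotone α v = record
  { mono   = above-mono α v
  ; strict = λ a → let u , u∈A , _ = above-nonempty α v a in u , u∈A
  }

module _ {m} (ns : Vec ℕ m) (C : Pred ℕ 0ℓ) (i : Fin m) (g : Fin (Vec.lookup ns i) → C (Vec.lookup ns i))
         (h : ∀ j → Fin (Vec.lookup ns j) → C (Vec.lookup ns j)) where

  -- `C` takes the size of the coordinate, so one construction alters a single component of a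
  -- labelling, of a family of Boolean sets or of a family of self-maps.
  override : ∀ j → Fin (Vec.lookup ns j) → C (Vec.lookup ns j)
  override j with j ≟ i
  ... | yes refl = g
  ... | no  _    = h j

  override-same : ∀ u → override i u ≡ g u
  override-same u with i ≟ i
  ... | yes refl = refl
  ... | no  i≢i  = ⊥-elim (i≢i refl)

  override-other : ∀ {j} → j ≢ i → ∀ u → override j u ≡ h j u
  override-other {j} j≢i u with j ≟ i
  ... | yes refl = ⊥-elim (j≢i refl)
  ... | no  _    = refl

Transform : ∀ {m} {ns : Vec ℕ m} (i : Fin m) →
            (Fin (Vec.lookup ns i) → (Fin (Vec.lookup ns i) → Bool) → Bool) → SubsetU ns → SubsetU ns
Transform i f S x = f (lookup x i) λ u → S (x [ i ≔ u ])

module _ {m} {ns : Vec ℕ m} (z₀ : U ns) (i : Fin m)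
         {f : Fin (Vec.lookup ns i) → (Fin (Vec.lookup ns i) → Bool) → Bool}
         (f-monotone : ∀ v → Monotone (f v))
         {S : SubsetU ns} (ample : LabelAmple S)
         (κ : Labelling ns) (meets : Meets κ (Transform i f S)) where

  private
    Uᵢ = Fin (Vec.lookup ns i)

    _~_ : U ns → U ns → Set
    y ~ z = ∀ j → j ≢ i → κ j (lookup y j) ≡ κ j (lookup z j)

    ~? : ∀ y z → Dec (y ~ z)
    ~? y z = all? λ j → ¬? (j ≟ i) →-dec (κ j (lookup y j) ≟ℕ κ j (lookup z j))

    Good : Pred Uᵢ 0ℓ
    Good u = ∀ z → ∃ λ y → T (S (y [ i ≔ u ])) × y ~ z

    good? : Decidable Good
    good? u = allᵁ? λ z → anyᵁ? λ y → T? (S (y [ i ≔ u ])) ×-dec ~? y z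

    X : Uᵢ → Bool
    X u = ⌊ good? u ⌋

    κ[_] : (Uᵢ → ℕ) → Labelling ns
    κ[ l ] = override ns (λ _ → ℕ) i l κ

    κ[]-same : ∀ l u → κ[ l ] i u ≡ l u
    κ[]-same l = override-same ns (λ _ → ℕ) i l κ

    κ[]-other : ∀ l {j} → j ≢ i → ∀ v → κ[ l ] j v ≡ κ j v
    κ[]-other l = override-other ns (λ _ → ℕ) i l κ

    -- A copy is a product: with the `i`-th coordinate fixed at `u`, the others can still be picked
    -- independently so as to reach every box. Labels of coordinate `i` do not enter, hence the
    -- arbitrary `l`.
    copy⇒good : ∀ {l} (C : Copy κ[ l ] S) {u} → T (Copy.W C i u) → Good u
    copy⇒good {l} C {u} u∈W z = y , W⊆S _ (≔-elim y i u (λ j v → T (W j v)) u∈W y∈W) , λ j j≢i →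
        trans (cong (κ j) (y≡w j))
          (trans (sym (κ[]-other l j≢i _)) (trans (proj₂ (proj₂ (w j))) (κ[]-other l j≢i _)))
      where
      open Copy C
      w = λ j → pick j (lookup z j)
      y : U ns
      y = lookup⁻ (λ j → proj₁ (w j))
      y≡w : ∀ j → lookup y j ≡ proj₁ (w j)
      y≡w = lookup∘lookup⁻ ns Fin (λ j → proj₁ (w j))
      y∈W : ∀ j → j ≢ i → T (W j (lookup y j))
      y∈W j _ = subst (T ∘ W j) (sym (y≡w j)) (proj₁ (proj₂ (w j)))

    witness : ∀ {l u} y z → y ~ z → T (S (y [ i ≔ u ])) → l u ≡ l (lookup z i) →
              ∃ λ y → T (S y) × ∀ j → κ[ l ] j (lookup y j) ≡ κ[ l ] j (lookup z j)
    witness {l} {u} y z y~z y∈S lu≡ = y [ i ≔ u ] , y∈S ,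
      ≔-elim y i u (λ j v → κ[ l ] j v ≡ κ[ l ] j (lookup z j))
        (trans (κ[]-same l u) (trans lu≡ (sym (κ[]-same l _))))
        λ j j≢i → trans (κ[]-other l j≢i _) (trans (y~z j j≢i) (sym (κ[]-other l j≢i _)))

    -- Good values have distinct successors as labels. With `b` zero the bad values form a block of
    -- their own; with `b` the label of a good value they are absorbed into its block.
    mergeBad : ℕ → Uᵢ → ℕ
    mergeBad b u = if X u then suc (toℕ u) else b

    mergeBad-good : ∀ {b u} → Good u → mergeBad b u ≡ suc (toℕ u)
    mergeBad-good {u = u} g with good? u
    ... | yes _ = refl
    ... | no ¬g = ⊥-elim (¬g g)

    mergeBad-bad : ∀ {b u} → ¬ Good u → mergeBad b u ≡ b
    mergeBad-bad {u = u} ¬g with good? u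
    ... | yes g = ⊥-elim (¬g g)
    ... | no _  = refl

    -- Otherwise the bad values of the i-th coordinate together meet everything, so after
    -- merging them into one block a copy would pass through one of them, making it good.
    holds-on-class : ∀ v → ∃ λ w → T (f w X) × κ i w ≡ κ i v
    holds-on-class v with any? (λ w → T? (f w X) ×-dec (κ i w ≟ℕ κ i v))
    ... | yes w = w
    ... | no ¬w = ⊥-elim contradict
      where
      bad : ∀ z → ∃₂ λ y u → ¬ Good u × T (S (y [ i ≔ u ])) × y ~ z
      bad z with meets (z [ i ≔ v ])
      ... | y , fy , y~ with any? (λ u → T? (S (y [ i ≔ u ])) ×-dec ¬? (good? u))
      ...   | yes (u , s , ¬g) = y , u , ¬g , s , λ j j≢i →
                trans (y~ j) (cong (κ j) (lookup-≔-other z v j≢i))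
      -- Here the trace of `S` on the line consists of good values, so monotonicity carries `f` from
      -- the trace to `X` at a value in the class of `v`, against `¬w`.
      ...   | no ¬u = ⊥-elim (¬w (lookup y i ,
                mono (f-monotone _) (λ u s → fromWitness (decidable-stable (good? u) λ ¬g → ¬u (u , s , ¬g))) fy ,
                trans (y~ i) (cong (κ i) (lookup-≔-same z i v))))

      merged : Meets κ[ mergeBad 0 ] S
      merged z with good? (lookup z i)
      ... | yes g = let y , s , y~ = g z in witness y z y~ s refl
      ... | no ¬g = let y , u , ¬gu , s , y~ = bad z in
                    witness y z y~ s (trans (mergeBad-bad ¬gu) (sym (mergeBad-bad ¬g)))

      C = ample _ merged
      u₀ = proj₁ (proj₂ (bad z₀))
      bad₀ = proj₁ (proj₂ (proj₂ (bad z₀)))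

      contradict : ⊥
      contradict with Copy.pick C i u₀
      ... | w , w∈W , eq with () ← trans (sym (mergeBad-good {0} (copy⇒good C w∈W)))
        (trans (sym (κ[]-same _ w)) (trans eq (trans (κ[]-same _ u₀) (mergeBad-bad bad₀))))

    x₀ : ∃ λ u → Good u
    x₀ = let w , fw , _ = holds-on-class (lookup z₀ i)
             u , Xu = strict (f-monotone w) fw
         in u , toWitness Xu

    absorbed : Meets κ[ mergeBad (suc (toℕ (proj₁ x₀))) ] S
    absorbed z with good? (lookup z i)
    ... | yes g = let y , s , y~ = g z in witness y z y~ s refl
    ... | no ¬g = let y , s , y~ = proj₂ x₀ z in
                  witness y z y~ s (trans (mergeBad-good (proj₂ x₀)) (sym (mergeBad-bad ¬g)))

    C : Copy κ[ mergeBad (suc (toℕ (proj₁ x₀))) ] S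
    C = ample _ absorbed
    open Copy C

    -- The element of `W` picked from the class of `u` is good by `copy⇒good`, and good values have
    -- distinct labels, so it is `u` itself.
    good⇒W : ∀ {u} → Good u → T (W i u)
    good⇒W {u} g with pick i u
    ... | w , w∈W , eq = subst (T ∘ W i) (toℕ-injective (ℕ.suc-injective
      (trans (sym (mergeBad-good (copy⇒good C w∈W)))
        (trans (sym (κ[]-same _ w)) (trans eq (trans (κ[]-same _ u) (mergeBad-good g))))))) w∈W

    V : ∀ j → Fin (Vec.lookup ns j) → Bool
    V = override ns (λ _ → Bool) i (λ u → f u X) W

  transform-copy : Copy κ (Transform i f S)
  transform-copy = record
    { W    = V
    ; pick = pickV
    -- Factor `i` of `W` contains all of `X`, so the trace of `S` on the line through `x` contains
    -- `X`, and monotonicity applies.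
    ; W⊆S  = λ x x∈V → mono (f-monotone _)
        (λ u Xu → W⊆S _ (≔-elim x i u (λ j v → T (W j v)) (good⇒W (toWitness Xu))
          λ j j≢i → subst T (override-other ns (λ _ → Bool) i _ W j≢i _) (x∈V j)))
        (subst T (override-same ns (λ _ → Bool) i _ W _) (x∈V i))
    }
    where
    pickV : ∀ j v → ∃ λ w → T (V j w) × κ j w ≡ κ j v
    pickV j v with j ≟ i
    ... | yes refl = holds-on-class v
    ... | no  j≢i  = let w , w∈W , eq = pick j v in
      w , w∈W , trans (sym (κ[]-other _ j≢i w)) (trans eq (κ[]-other _ j≢i v))

transform-ample : ∀ {m} {ns : Vec ℕ m} (z₀ : U ns) i {f} → (∀ v → Monotone (f v)) →
                  {S : SubsetU ns} → LabelAmple S → LabelAmple (Transform i f S)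
transform-ample z₀ i f-monotone ample = transform-copy z₀ i f-monotone ample

-- Substitutions in the coordinates

module _ {m} {ns : Vec ℕ m} (ρ : ∀ k → Fin (Vec.lookup ns k) → Fin (Vec.lookup ns k)) where

  substitute : U ns → U ns
  substitute y = lookup⁻ λ k → ρ k (lookup y k)

  lookup-substitute : ∀ y k → lookup (substitute y) k ≡ ρ k (lookup y k)
  lookup-substitute y = lookup∘lookup⁻ ns Fin λ k → ρ k (lookup y k)

  private
    substituteAt : List (Fin m) → U ns → U ns
    substituteAt []       y = y
    substituteAt (i ∷ is) y = substituteAt is (y [ i ≔ ρ i (lookup y i) ])

    outside-list : ∀ is {k} → k ∉ˡ is → ∀ y → lookup (substituteAt is y) k ≡ lookup y k
    outside-list []       k∉ y = refl
    outside-list (i ∷ is) k∉ y =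
      trans (outside-list is (k∉ ∘ there) _) (lookup-≔-other y _ (k∉ ∘ here))

    inside-list : ∀ {is k} → Unique is → k ∈ˡ is → ∀ y →
                  lookup (substituteAt is y) k ≡ ρ k (lookup y k)
    inside-list {i ∷ is} (i∉ ∷ _) (here refl) y =
      trans (outside-list is (λ k∈ → lookupˡ i∉ k∈ refl) _) (lookup-≔-same y i _)
    inside-list {i ∷ is} {k} (i∉ ∷ is!) (there k∈) y =
      trans (inside-list is! k∈ _)
        (cong (ρ k) (lookup-≔-other y (ρ i (lookup y i)) λ k≡i → lookupˡ i∉ k∈ (sym k≡i)))

    substituteAt-ample : U ns → ∀ {S} → LabelAmple S → ∀ is → LabelAmple (S ∘ substituteAt is)
    substituteAt-ample z₀ ample []       = ample
    substituteAt-ample z₀ ample (i ∷ is) = transform-ample z₀ i {λ v A → A (ρ i v)}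
      (λ v → record { mono = λ A⊆B → A⊆B _ ; strict = λ a → _ , a })
      (substituteAt-ample z₀ ample is)

  -- Evaluation at `ρ i v` is a monotone function of a line, so substituting in one coordinate is an
  -- instance of `Transform`; doing so once in each coordinate gives the whole substitution.
  substitute-ample : U ns → {S : SubsetU ns} → LabelAmple S → LabelAmple (S ∘ substitute)
  substitute-ample z₀ {S} ample = labelAmple-resp-≐
    (λ y → cong S (lookup-ext λ k → trans (inside-list (allFin⁺ m) (∈-allFin k) y)
      (sym (lookup-substitute y k))))
    (substituteAt-ample z₀ ample (allFin m))

-- Exchanging monotone functions in two coordinates

module _ {m} {ns : Vec ℕ m} {S : SubsetU ns} (ample : LabelAmple S) (x : U ns) {i j : Fin m} (i≢j : i ≢ j)
         {f : (Fin (Vec.lookup ns i) → Bool) → Bool} (f-monotone : Monotone f)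
         {g : (Fin (Vec.lookup ns j) → Bool) → Bool} (g-monotone : Monotone g) where

  private
    _⊕_ : Fin (Vec.lookup ns j) → Fin (Vec.lookup ns i) → U ns
    v ⊕ u = x [ j ≔ v ] [ i ≔ u ]

    X : Fin (Vec.lookup ns i) → Bool
    X u = g λ v → S (v ⊕ u)

    Y : Fin (Vec.lookup ns j) → Bool
    Y v = f λ u → S (v ⊕ u)

  -- If f X failed, every column v ∈ Y would meet S outside X.  Collapsing the i-th coordinate onto
  -- the complement of X, the j-th onto Y and freezing the others, ampleness gives a single u ∉ X
  -- whose row contains Y, contradicting the definition of X.
  exchange : T (g Y) → T (f X)
  exchange gY with T? (f X)
  ... | yes fX = fX
  ... | no ¬fX = ⊥-elim (φ-outside a
    (mono g-monotone (λ v Yv → subst (λ v → T (S (v ⊕ φ a))) (ψ-id Yv) (row v)) gY))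
    where
    column : ∀ {v} → T (Y v) → ∃ λ u → ¬ T (X u) × T (S (v ⊕ u))
    column {v} Yv with any? (λ u → ¬? (T? (X u)) ×-dec T? (S (v ⊕ u)))
    ... | yes w = w
    ... | no ¬w = ⊥-elim (¬fX (mono f-monotone
      (λ u s → decidable-stable (T? (X u)) λ ¬Xu → ¬w (u , ¬Xu , s)) Yv))

    v₀∈Y = strict g-monotone gY
    u₀∉X = column (proj₂ v₀∈Y)

    φ : Fin (Vec.lookup ns i) → Fin (Vec.lookup ns i)
    φ u with T? (X u)
    ... | yes _ = proj₁ u₀∉X
    ... | no  _ = u

    φ-outside : ∀ u → ¬ T (X (φ u))
    φ-outside u with T? (X u)
    ... | yes _ = proj₁ (proj₂ u₀∉X)
    ... | no ¬Xu = ¬Xu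

    φ-id : ∀ {u} → ¬ T (X u) → φ u ≡ u
    φ-id {u} ¬Xu with T? (X u)
    ... | yes Xu = ⊥-elim (¬Xu Xu)
    ... | no  _  = refl

    ψ : Fin (Vec.lookup ns j) → Fin (Vec.lookup ns j)
    ψ v with T? (Y v)
    ... | yes _ = v
    ... | no  _ = proj₁ v₀∈Y

    ψ-inside : ∀ v → T (Y (ψ v))
    ψ-inside v with T? (Y v)
    ... | yes Yv = Yv
    ... | no  _  = proj₂ v₀∈Y

    ψ-id : ∀ {v} → T (Y v) → ψ v ≡ v
    ψ-id {v} Yv with T? (Y v)
    ... | yes _  = refl
    ... | no ¬Yv = ⊥-elim (¬Yv Yv)

    ρ′ ρ : ∀ k → Fin (Vec.lookup ns k) → Fin (Vec.lookup ns k)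
    ρ′ = override ns Fin j ψ (λ k _ → lookup x k)
    ρ  = override ns Fin i φ ρ′

    substitute≡ : ∀ y → substitute ρ y ≡ ψ (lookup y j) ⊕ φ (lookup y i)
    substitute≡ y = lookup-ext λ k → trans (lookup-substitute ρ y k)
      (≔-elim (x [ j ≔ ψ (lookup y j) ]) i _ (λ k v → ρ k (lookup y k) ≡ v)
        (override-same ns Fin i φ ρ′ _)
        (λ k k≢i → trans (override-other ns Fin i φ ρ′ k≢i _)
          (≔-elim x j _ (λ k v → ρ′ k (lookup y k) ≡ v)
            (override-same ns Fin j ψ _ _) (λ k k≢j → override-other ns Fin j ψ _ k≢j _) k)) k)

    -- Discrete in direction `j`, which forces the `j`-th factor of a copy to be full; a single
    -- class elsewhere, so that one value `a` in direction `i` serves all columns.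
    κ : Labelling ns
    κ = override ns (λ _ → ℕ) j toℕ (λ _ _ → 0)

    κ-constant : ∀ {k} → k ≢ j → ∀ u v → κ k u ≡ κ k v
    κ-constant k≢j u v = trans (zeros u) (sym (zeros v))
      where zeros = override-other ns (λ _ → ℕ) j toℕ (λ _ _ → 0) k≢j

    κ-discrete : ∀ {u v} → κ j u ≡ κ j v → u ≡ v
    κ-discrete {u} {v} eq = toℕ-injective (trans (sym (labels u)) (trans eq (labels v)))
      where labels = override-same ns (λ _ → ℕ) j toℕ (λ _ _ → 0)

    copy : Copy κ (S ∘ substitute ρ)
    copy = substitute-ample ρ x ample κ λ z →
      let u , u∉X , s = column (ψ-inside (lookup z j)) in
      z [ i ≔ u ] ,
      subst (T ∘ S) (sym (trans (substitute≡ (z [ i ≔ u ]))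
        (cong₂ _⊕_ (cong ψ (lookup-≔-other z u (i≢j ∘ sym)))
                   (trans (cong φ (lookup-≔-same z i u)) (φ-id u∉X))))) s ,
      ≔-elim z i u (λ k v → κ k v ≡ κ k (lookup z k)) (κ-constant i≢j _ _) (λ _ _ → refl)
    open Copy copy

    a = proj₁ (pick i (proj₁ u₀∉X))
    a∈W = proj₁ (proj₂ (pick i (proj₁ u₀∉X)))

    w : U ns
    w = lookup⁻ λ k → proj₁ (pick k (lookup x k))

    w∈W : ∀ k → T (W k (lookup w k))
    w∈W k = subst (T ∘ W k) (sym (lookup∘lookup⁻ ns Fin (λ k → proj₁ (pick k (lookup x k))) k))
      (proj₁ (proj₂ (pick k (lookup x k))))

    full : ∀ v → T (W j v)
    full v = let v′ , v′∈W , eq = pick j v in subst (T ∘ W j) (κ-discrete eq) v′∈W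

    row : ∀ v → T (S (ψ v ⊕ φ a))
    row v = subst (T ∘ S)
      (trans (substitute≡ y)
        (cong₂ _⊕_ (cong ψ (trans (lookup-≔-other (w [ j ≔ v ]) a (i≢j ∘ sym)) (lookup-≔-same w j v)))
                   (cong φ (lookup-≔-same (w [ j ≔ v ]) i a))))
      (W⊆S y (≔-elim (w [ j ≔ v ]) i a (λ k v → T (W k v)) a∈W λ k _ →
        ≔-elim w j v (λ k v → T (W k v)) (full v) (λ k _ → w∈W k) k))
      where
      y = w [ j ≔ v ] [ i ≔ a ]

-- Push downs of ample sets

≔-comm : ∀ (x : U ns) {i j} u v → i ≢ j → x [ i ≔ u ] [ j ≔ v ] ≡ x [ j ≔ v ] [ i ≔ u ]
≔-comm (_ ∷ xs) {zero}  {zero}  u v i≢j = ⊥-elim (i≢j refl)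
≔-comm (_ ∷ xs) {zero}  {suc j} u v i≢j = refl
≔-comm (_ ∷ xs) {suc i} {zero}  u v i≢j = refl
≔-comm (x ∷ xs) {suc i} {suc j} u v i≢j = cong (x ∷_) (≔-comm xs u v (i≢j ∘ cong suc))

compress : ∀ {ns : Vec ℕ m} (M : OneDim ns) → Fin (Vec.lookup ns (dir M)) →
           (Fin (Vec.lookup ns (dir M)) → Bool) → Bool
compress M = above (lookup (OneDim.Λ M) (dir M))

compress-monotone : ∀ (M : OneDim ns) v → Monotone (compress M v)
compress-monotone M = above-monotone (lookup (OneDim.Λ M) (dir M))

pushDown-ample : U ns → ∀ {S : SubsetU ns} M → LabelAmple S → LabelAmple (S [ M ↓])
pushDown-ample z₀ {S} M ample = labelAmple-resp-≐ (λ x → sym (pushDown S M x))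
  (transform-ample z₀ (dir M) (compress-monotone M) ample)

↓-cong : ∀ {S S′ : SubsetU ns} M → S ≐ᵁ S′ → S [ M ↓] ≐ᵁ S′ [ M ↓]
↓-cong {S = S} {S′} M eq x = trans (pushDown S M x)
  (trans (cong-≗ (compress-monotone M _) (λ u → eq _)) (sym (pushDown S′ M x)))

↓*-cong : ∀ {S S′ : SubsetU ns} Ms → S ≐ᵁ S′ → S [ Ms ↓*] ≐ᵁ S′ [ Ms ↓*]
↓*-cong []       eq = eq
↓*-cong (M ∷ Ms) eq = ↓*-cong Ms (↓-cong M eq)

pushDown² : ∀ (S : SubsetU ns) M N → dir M ≢ dir N → ∀ x →
  (S [ M ↓] [ N ↓]) x ≡
  compress N (lookup x (dir N)) λ v → compress M (lookup x (dir M)) λ u → S (x [ dir N ≔ v ] [ dir M ≔ u ])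
pushDown² S M N i≢j x = trans (pushDown (S [ M ↓]) N x) (cong-≗ (compress-monotone N _) λ v →
  trans (pushDown S M (x [ dir N ≔ v ]))
    (cong (λ w → compress M w λ u → S (x [ dir N ≔ v ] [ dir M ≔ u ])) (lookup-≔-other x v i≢j)))

-- `exchange` gives one implication; the other is the same with `M` and `N` interchanged.
pushDown-comm : ∀ {S : SubsetU ns} → LabelAmple S → ∀ M N → dir M ≢ dir N →
                S [ M ↓] [ N ↓] ≐ᵁ S [ N ↓] [ M ↓]
pushDown-comm {S = S} ample M N i≢j x = T-ext (half M N i≢j) (half N M (i≢j ∘ sym))
  where
  half : ∀ M N → dir M ≢ dir N → T ((S [ M ↓] [ N ↓]) x) → T ((S [ N ↓] [ M ↓]) x)
  half M N i≢j t = subst T (sym (trans (pushDown² S N M (i≢j ∘ sym) x)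
      (cong-≗ (compress-monotone M _) λ u → cong-≗ (compress-monotone N _) λ v →
        cong S (≔-comm x u v i≢j))))
    (exchange ample x i≢j (compress-monotone M _) (compress-monotone N _)
      (subst T (pushDown² S M N i≢j x) t))

-- Induction on the derivation of the permutation. A swap at the front is `pushDown-comm`; since
-- push downs preserve ampleness, the induction hypothesis applies to the set already pushed.
labelAmple⇒commute : U ns → ∀ {S : SubsetU ns} → LabelAmple S → SerialPushDownsCommute S
labelAmple⇒commute z₀ ample Ms .Ms Ms! _↭_.refl = λ _ → refl
labelAmple⇒commute z₀ ample (M ∷ Ms) (.M ∷ Ms′) (_ ∷ Ms!) (_↭_.prep .M Ms↭) =
  labelAmple⇒commute z₀ (pushDown-ample z₀ M ample) Ms Ms′ Ms! Ms↭
labelAmple⇒commute z₀ ample (M ∷ N ∷ Ms) (.N ∷ .M ∷ Ms′) ((M≢N ∷ _) ∷ _ ∷ Ms!) (_↭_.swap .M .N Ms↭) x =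
  trans (labelAmple⇒commute z₀ (pushDown-ample z₀ N (pushDown-ample z₀ M ample)) Ms Ms′ Ms! Ms↭ x)
        (↓*-cong Ms′ (pushDown-comm ample M N M≢N) x)
labelAmple⇒commute z₀ ample Ms Ms″ Ms! (_↭_.trans {ys = Ms′} p q) x =
  trans (labelAmple⇒commute z₀ ample Ms Ms′ Ms! p x)
        (labelAmple⇒commute z₀ ample Ms′ Ms″
          (↭ₛ.Unique-resp-↭ (setoid _) (↭⇒↭ₛ (↭-map⁺ dir p)) Ms!) q x)

-- Push downs with one more coordinate

discrete : ∀ n → Partition n
discrete n = record
  { size     = n
  ; block    = ⁅_⁆
  ; nonempty = λ b → b , x∈⁅x⁆ b
  ; cover    = λ x → x , x∈⁅x⁆ x , x∈⁅y⁆⇒x≡y _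
  }

-- The new coordinate gets singleton blocks, so that a lifted push down acts on each slice
-- separately.
lift : OneDim ns → OneDim (n ∷ ns)
lift {n = n} M = record
  { Λ      = discrete n ∷ OneDim.Λ M
  ; oneDim = suc (dir M) , proj₁ (proj₂ (OneDim.oneDim M)) , λ
      { {zero}  (b , neq) → ⊥-elim (neq (∣⁅x⁆∣≡1 b))
      ; {suc j} sup       → cong suc (proj₂ (proj₂ (OneDim.oneDim M)) sup) }
  }

lift-↓ : ∀ (S : SubsetU (n ∷ ns)) M v y → (S [ lift M ↓]) (v ∷ y) ≡ ((λ y → S (v ∷ y)) [ M ↓]) y
lift-↓ S M v y = trans (pushDown S (lift M) (v ∷ y)) (sym (pushDown (λ y → S (v ∷ y)) M y))

lift-↓* : ∀ (S : SubsetU (n ∷ ns)) Ms v y →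
          (S [ map lift Ms ↓*]) (v ∷ y) ≡ ((λ y → S (v ∷ y)) [ Ms ↓*]) y
lift-↓* S []       v y = refl
lift-↓* S (M ∷ Ms) v y =
  trans (lift-↓* (S [ lift M ↓]) Ms v y) (↓*-cong Ms (λ y → lift-↓ S M v y) y)

map-dir-lift : ∀ (Ms : List (OneDim ns)) → map dir (map (lift {n = n}) Ms) ≡ map suc (map dir Ms)
map-dir-lift []       = refl
map-dir-lift (M ∷ Ms) = cong (suc (dir M) ∷_) (map-dir-lift Ms)

discretes : (ns : Vec ℕ m) → GenPartition ns
discretes ns = lookup⁻ λ j → discrete (Vec.lookup ns j)

∣discretes∣≡1 : ∀ (ns : Vec ℕ m) j b → ∣ block (lookup (discretes ns) j) b ∣ ≡ 1
∣discretes∣≡1 ns j rewrite lookup∘lookup⁻ ns Partition (λ j → discrete (Vec.lookup ns j)) j = ∣⁅x⁆∣≡1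

headOneDim : ∀ (ns : Vec ℕ m) (κ : Fin n → ℕ) {u v} → u ≢ v → κ u ≡ κ v → OneDim (n ∷ ns)
headOneDim ns κ {u} {v} u≢v κu≡κv = record
  { Λ      = classes κ ∷ discretes ns
  ; oneDim = zero , (blockOf (classes κ) v , λ eq → u≢v (∣p∣≡1⇒unique eq
      (blockOf⇒∈ (classes κ) (classes-complete κ κu≡κv)) (∈-blockOf (classes κ) v))) , λ
      { {zero}  _         → refl
      ; {suc j} (b , neq) → ⊥-elim (neq (∣discretes∣≡1 ns j b)) }
  }

-- Extreme elements of a block

-- Serves to compare a block with its part below its greatest element, which misses only that
-- element.
∣p∣≤1+∣q∣ : ∀ {p q : Subset n} x → (∀ {y} → y ≢ x → y ∈ p → y ∈ q) → ∣ p ∣ ≤ suc ∣ q ∣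
∣p∣≤1+∣q∣ {p = s ∷ p} {t ∷ q} zero f = ≤-trans (∣s∷p∣≤ s) (s≤s (≤-trans
  (p⊆q⇒∣p∣≤∣q∣ λ y∈p → there⁻ (f (λ ()) (Vec.there y∈p))) (∣p∣≤∣x∷p∣ t q)))
  where
  there⁻ : ∀ {y} → suc y ∈ t ∷ q → y ∈ q
  there⁻ (Vec.there y∈) = y∈
  ∣s∷p∣≤ : ∀ s → ∣ s ∷ p ∣ ≤ suc ∣ p ∣
  ∣s∷p∣≤ true  = ≤-refl
  ∣s∷p∣≤ false = ℕ.n≤1+n _
∣p∣≤1+∣q∣ {p = s ∷ p} {t ∷ q} (suc x) f with ∣p∣≤1+∣q∣ {p = p} {q} x
  (λ y≢x y∈p → there⁻ (f (y≢x ∘ suc-injective) (Vec.there y∈p)))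
  where
  there⁻ : ∀ {y} → suc y ∈ t ∷ q → y ∈ q
  there⁻ (Vec.there y∈) = y∈
∣p∣≤1+∣q∣ {p = true  ∷ p} {true  ∷ q} (suc x) f | r = s≤s r
∣p∣≤1+∣q∣ {p = true  ∷ p} {false ∷ q} (suc x) f | r with () ← f {zero} (λ ()) Vec.here
∣p∣≤1+∣q∣ {p = false ∷ p} {t ∷ q}     (suc x) f | r = ≤-trans r (s≤s (∣p∣≤∣x∷p∣ t q))

least : ∀ {n} {P : Fin n → Bool} {u} → T (P u) → ∃ λ v → T (P v) × ∀ {w} → T (P w) → ¬ w <ᶠ v
least {suc n} {P} {u} Pu with T? (P zero)
... | yes P0 = zero , P0 , λ _ ()
least {suc n} {P} {zero}  Pu | no ¬P0 = ⊥-elim (¬P0 Pu)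
least {suc n} {P} {suc u} Pu | no ¬P0 with least {P = P ∘ suc} Pu
... | v , Pv , min = suc v , Pv , λ { {zero} P0 → ⊥-elim (¬P0 P0) ; {suc w} Pw (s≤s lt) → min Pw lt }

greatest : ∀ {n} {P : Fin n → Bool} {u} → T (P u) → ∃ λ v → T (P v) × ∀ {w} → T (P w) → ¬ v <ᶠ w
greatest {suc n} {P} {u} Pu with any? (λ u → T? (P (suc u)))
... | yes (u′ , Pu′) = let v , Pv , max = greatest {P = P ∘ suc} Pu′ in
  suc v , Pv , λ { {suc w} Pw (s≤s lt) → max Pw lt }
greatest {suc n} {P} {zero}  Pu | no ¬P = zero , Pu , λ { {suc w} Pw _ → ¬P (w , Pw) }
greatest {suc n} {P} {suc u} Pu | no ¬P = ⊥-elim (¬P (u , Pu))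

module _ (α : Partition n) {v : Fin n} {A : Fin n → Bool} where

  -- No element of the block lies below `v`, so the threshold is zero and the trace only has to be
  -- nonempty.
  above-least : (∀ {w} → w ∈ block α (blockOf α v) → ¬ w <ᶠ v) →
                T (above α v A) ⇔ ∃ λ u → u ∈ block α (blockOf α v) × T (A u)
  above-least min = mk⇔
    (λ a → let u , Au , u∈ = above-nonempty α v a in u , u∈ , Au)
    (λ (u , u∈ , Au) → fromWitness (card-strict (below? α v) (within? α v A)
      (λ (w∈ , w<v) → ⊥-elim (min w∈ w<v)) (u , (Au , u∈) , λ (u∈ , u<v) → min u∈ u<v)))

  -- All elements of the block except `v` lie below `v`, so exceeding the threshold means filling
  -- the block.
  above-greatest : (∀ {w} → w ∈ block α (blockOf α v) → ¬ v <ᶠ w) →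
                   T (above α v A) ⇔ (∀ u → u ∈ block α (blockOf α v) → T (A u))
  above-greatest max = mk⇔
    (λ a u u∈ → decidable-stable (T? (A u)) λ ¬Au → ℕ.<⇒≱ (toWitness a) (s≤s⁻¹
      (≤-trans (card-strict (within? α v A) (_∈? B) proj₂ (u , u∈ , λ (Au , _) → ¬Au Au))
               (∣p∣≤1+∣q∣ v λ {w} w≢v w∈ → ∈⟨⟩⁺ (below? α v) (∈⟨⟩⁻ (_∈? B) w∈ , below w≢v (∈⟨⟩⁻ (_∈? B) w∈))))))
    (λ all → fromWitness (card-strict (below? α v) (within? α v A)
      (λ (w∈ , _) → all _ w∈ , w∈)
      (v , (all v (∈-blockOf α v) , ∈-blockOf α v) , λ (_ , v<v) → Fin.<-irrefl refl v<v)))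
    where
    B = block α (blockOf α v)
    below : ∀ {w} → w ≢ v → w ∈ B → w <ᶠ v
    below {w} w≢v w∈ with Fin.<-cmp w v
    ... | tri< w<v _ _ = w<v
    ... | tri≈ _ w≡v _ = ⊥-elim (w≢v w≡v)
    ... | tri> _ _ v<w = ⊥-elim (max w∈ v<w)

collapse : (Fin n → Bool) → Fin n → ℕ
collapse P u = if P u then 0 else suc (toℕ u)

collapse-complete : ∀ (P : Fin n → Bool) {u v} → T (P u) → T (P v) → collapse P u ≡ collapse P v
collapse-complete P {u} {v} Pu Pv with P u | P v
... | true | true = refl

collapse-sound : ∀ (P : Fin n → Bool) {u v} → T (P v) → collapse P u ≡ collapse P v → T (P u)
collapse-sound P {u} {v} Pv eq with P u | P v
... | true | true = _
... | false | true with () ← eq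

-- Quantifiers realised by push downs

-- A quantifier over the first coordinate that push downs compute for all `y` at once, read at the
-- fixed value `at`. `fresh` prepends to any repetition-free list, which also covers an empty `Ms`.
record HeadPush {m} (n : ℕ) (ns : Vec ℕ m) (Q : (Fin n → Set) → Set) : Set₁ where
  field
    mono  : ∀ {F G} → (∀ u → F u → G u) → Q F → Q G
    Ms    : List (OneDim (n ∷ ns))
    at    : Fin n
    spec  : ∀ S y → T ((S [ Ms ↓*]) (at ∷ y)) ⇔ Q (λ u → T (S (u ∷ y)))
    fresh : ∀ {is} → Unique is → Unique (map dir Ms ++ map suc is)

record TailPush {m} (ns : Vec ℕ m) (R : (U ns → Set) → Set) : Set₁ where
  field
    mono   : ∀ {F G} → (∀ y → F y → G y) → R F → R G
    Ms     : List (OneDim ns)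
    at     : U ns
    spec   : ∀ S → T ((S [ Ms ↓*]) at) ⇔ R (λ y → T (S y))
    unique : Unique (map dir Ms)

module _ (ns : Vec ℕ m) (P : Fin n → Bool) {u₀} (Pu₀ : T (P u₀)) where

  private
    α = classes (collapse P)

    ∈block : ∀ {u v} → T (P v) → T (P u) → u ∈ block α (blockOf α v)
    ∈block Pv Pu = blockOf⇒∈ α (classes-complete (collapse P) (collapse-complete P Pu Pv))

    block∈ : ∀ {u v} → T (P v) → u ∈ block α (blockOf α v) → T (P u)
    block∈ Pv u∈ = collapse-sound P Pv (classes-sound (collapse P) (∈⇒blockOf α u∈))

    nontrivial? : Dec (∃ λ u → T (P u) × u ≢ u₀)
    nontrivial? = any? λ u → T? (P u) ×-dec ¬? (u ≟ u₀)

    only : ¬ (∃ λ u → T (P u) × u ≢ u₀) → ∀ {u} → T (P u) → u ≡ u₀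
    only triv {u} Pu = decidable-stable (u ≟ u₀) λ u≢u₀ → triv (u , Pu , u≢u₀)

    push : (∃ λ u → T (P u) × u ≢ u₀) → OneDim (n ∷ ns)
    push (u , Pu , u≢u₀) = headOneDim ns (collapse P) u≢u₀ (collapse-complete P Pu Pu₀)

    fresh₀ : ∀ {is : List (Fin m)} → Unique is → Unique (zero ∷ map suc is)
    fresh₀ {is} is! = Allˡ-map⁺ (universal (λ _ ()) is) ∷ Unique-map⁺ suc-injective is!

  -- If P is a singleton then collapsing it gives no one-dimensional minor-subproduct, and nothing is pushed.
  ∃-head : HeadPush n ns (λ F → ∃ λ u → T (P u) × F u)
  ∃-head with nontrivial?
  ... | no triv = record
    { mono  = λ f (u , Pu , Fu) → u , Pu , f u Fu
    ; Ms    = []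
    ; at    = u₀
    ; spec  = λ S y → mk⇔ (λ s → u₀ , Pu₀ , s)
                          (λ (u , Pu , s) → subst (λ u → T (S (u ∷ y))) (only triv Pu) s)
    ; fresh = Unique-map⁺ suc-injective
    }
  ... | yes non = record
    { mono  = λ f (u , Pu , Fu) → u , Pu , f u Fu
    ; Ms    = M ∷ []
    ; at    = v
    ; spec  = λ S y → let e = above-least α {v} {λ u → S (u ∷ y)} (λ w∈ → min (block∈ Pv w∈)) in mk⇔
        (λ s → let u , u∈ , Su = to e (subst T (pushDown S M (v ∷ y)) s) in u , block∈ Pv u∈ , Su)
        (λ (u , Pu , Su) → subst T (sym (pushDown S M (v ∷ y))) (from e (u , ∈block Pv Pu , Su)))
    ; fresh = fresh₀
    }
    where
    M = push non
    v = proj₁ (least {P = P} Pu₀)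
    Pv = proj₁ (proj₂ (least {P = P} Pu₀))
    min : ∀ {w} → T (P w) → ¬ w <ᶠ v
    min = proj₂ (proj₂ (least {P = P} Pu₀))

  ∀-head : HeadPush n ns (λ F → ∀ u → T (P u) → F u)
  ∀-head with nontrivial?
  ... | no triv = record
    { mono  = λ f all u Pu → f u (all u Pu)
    ; Ms    = []
    ; at    = u₀
    ; spec  = λ S y → mk⇔ (λ s u Pu → subst (λ u → T (S (u ∷ y))) (sym (only triv Pu)) s)
                          (λ all → all u₀ Pu₀)
    ; fresh = Unique-map⁺ suc-injective
    }
  ... | yes non = record
    { mono  = λ f all u Pu → f u (all u Pu)
    ; Ms    = M ∷ []
    ; at    = v
    ; spec  = λ S y → let e = above-greatest α {v} {λ u → S (u ∷ y)} (λ w∈ → max (block∈ Pv w∈)) in mk⇔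
        (λ s u Pu → to e (subst T (pushDown S M (v ∷ y)) s) u (∈block Pv Pu))
        (λ all → subst T (sym (pushDown S M (v ∷ y))) (from e λ u u∈ → all u (block∈ Pv u∈)))
    ; fresh = fresh₀
    }
    where
    M = push non
    v = proj₁ (greatest {P = P} Pu₀)
    Pv = proj₁ (proj₂ (greatest {P = P} Pu₀))
    max : ∀ {w} → T (P w) → ¬ v <ᶠ w
    max = proj₂ (proj₂ (greatest {P = P} Pu₀))

-- Exchanging quantifiers by commutation

module _ {ns : Vec ℕ m} {Q : (Fin n → Set) → Set} (h : HeadPush n ns Q) where
  private module H = HeadPush h

  -- By `spec` this collects the `y` whose fibre satisfies `Q`: for `∃-head` the union, for `∀-head`
  -- the intersection of the slices of `S` over `P`.
  slice : SubsetU (n ∷ ns) → SubsetU ns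
  slice S y = (S [ H.Ms ↓*]) (H.at ∷ y)

  slice-↓* : ∀ S Ms y → (S [ H.Ms ++ map lift Ms ↓*]) (H.at ∷ y) ≡ (slice S [ Ms ↓*]) y
  slice-↓* S Ms y = trans (cong (λ X → X (H.at ∷ y)) (foldl-++ _[_↓] S H.Ms (map lift Ms)))
                          (lift-↓* (S [ H.Ms ↓*]) Ms H.at y)

  unique-dirs : ∀ {Ms : List (OneDim ns)} → Unique (map dir Ms) → Unique (map dir (H.Ms ++ map lift Ms))
  unique-dirs {Ms} Ms! = subst Unique
    (sym (trans (map-++ dir H.Ms (map lift Ms)) (cong (map dir H.Ms ++_) (map-dir-lift Ms)))) (H.fresh Ms!)

  -- Pushing down the slice amounts to a longer serial push down of `S` that begins with `H.Ms`, and
  -- this prefix is common to both orders.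
  slice-commute : ∀ {S} → SerialPushDownsCommute S → SerialPushDownsCommute (slice S)
  slice-commute {S} commute Ms Ms′ Ms! Ms↭ y = trans (sym (slice-↓* S Ms y))
    (trans (commute _ _ (unique-dirs Ms!) (++⁺ˡ H.Ms (↭-map⁺ lift Ms↭)) (H.at ∷ y)) (slice-↓* S Ms′ y))

  module _ {R : (U ns → Set) → Set} (t : TailPush ns R) where
    private module R = TailPush t

    -- The push downs performed first realise the inner quantifier.
    head-first : ∀ S → T ((S [ H.Ms ++ map lift R.Ms ↓*]) (H.at ∷ R.at)) ⇔
                       R (λ y → Q (λ u → T (S (u ∷ y))))
    head-first S = mk⇔
      (λ s → R.mono (λ y → to (H.spec S y)) (to (R.spec (slice S)) (subst T (slice-↓* S R.Ms R.at) s)))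
      (λ r → subst T (sym (slice-↓* S R.Ms R.at)) (from (R.spec (slice S)) (R.mono (λ y → from (H.spec S y)) r)))

    tail-first : ∀ S → T ((S [ map lift R.Ms ++ H.Ms ↓*]) (H.at ∷ R.at)) ⇔
                       Q (λ u → R (λ y → T (S (u ∷ y))))
    tail-first S = mk⇔
      (λ s → H.mono (λ u s → to (R.spec _) (subst T (lift-↓* S R.Ms u R.at) s))
        (to (H.spec (S [ map lift R.Ms ↓*]) R.at) (subst T split s)))
      (λ q → subst T (sym split) (from (H.spec (S [ map lift R.Ms ↓*]) R.at)
        (H.mono (λ u r → subst T (sym (lift-↓* S R.Ms u R.at)) (from (R.spec _) r)) q)))
      where
      split : (S [ map lift R.Ms ++ H.Ms ↓*]) (H.at ∷ R.at) ≡ (S [ map lift R.Ms ↓*] [ H.Ms ↓*]) (H.at ∷ R.at)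
      split = cong (λ X → X (H.at ∷ R.at)) (foldl-++ _[_↓] S (map lift R.Ms) H.Ms)

    quantifiers-swap : ∀ {S} → SerialPushDownsCommute S →
      R (λ y → Q (λ u → T (S (u ∷ y)))) ⇔ Q (λ u → R (λ y → T (S (u ∷ y))))
    quantifiers-swap {S} commute = mk⇔
      (λ r → to (tail-first S) (subst T orders (from (head-first S) r)))
      (λ q → to (head-first S) (subst T (sym orders) (from (tail-first S) q)))
      where
      orders = commute _ _ (unique-dirs R.unique) (++-comm H.Ms (map lift R.Ms)) (H.at ∷ R.at)

    cons-push : ∀ {R′ : (U (n ∷ ns) → Set) → Set} →
                (∀ F → R (λ y → Q (λ u → F (u ∷ y))) ⇔ R′ F) → TailPush (n ∷ ns) R′
    cons-push eq = record
      { mono   = λ f r → to (eq _) (R.mono (λ y → H.mono λ u → f (u ∷ y)) (from (eq _) r))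
      ; Ms     = H.Ms ++ map lift R.Ms
      ; at     = H.at ∷ R.at
      ; spec   = λ S → mk⇔ (to (eq _) ∘ to (head-first S)) (from (head-first S) ∘ from (eq _))
      ; unique = unique-dirs R.unique
      }

InProduct : ∀ {m} {ns : Vec ℕ m} → (∀ j → Fin (Vec.lookup ns j) → Bool) → U ns → Set
InProduct P y = ∀ j → T (P j (lookup y j))

∃-tail : ∀ {m} {ns : Vec ℕ m} (P : ∀ j → Fin (Vec.lookup ns j) → Bool) (y₀ : U ns) →
         InProduct {ns = ns} P y₀ → TailPush ns (λ F → ∃ λ y → InProduct {ns = ns} P y × F y)
∃-tail {ns = []} P [] y₀∈ = record
  { mono   = λ f (y , y∈ , Fy) → y , y∈ , f y Fy
  ; Ms     = []
  ; at     = []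
  ; spec   = λ S → mk⇔ (λ s → [] , (λ ()) , s) (λ { ([] , _ , s) → s })
  ; unique = []
  }
∃-tail {ns = n ∷ ns} P (u₀ ∷ y₀) y₀∈ =
  cons-push (∃-head ns (P zero) (y₀∈ zero)) (∃-tail (λ j → P (suc j)) y₀ λ j → y₀∈ (suc j)) λ F → mk⇔
    (λ (y , y∈ , u , u∈ , Fuy) → u ∷ y , (λ { zero → u∈ ; (suc j) → y∈ j }) , Fuy)
    (λ { (u ∷ y , uy∈ , Fuy) → y , (λ j → uy∈ (suc j)) , u , uy∈ zero , Fuy })

∀-tail : ∀ {m} {ns : Vec ℕ m} (P : ∀ j → Fin (Vec.lookup ns j) → Bool) (y₀ : U ns) →
         InProduct {ns = ns} P y₀ → TailPush ns (λ F → ∀ y → InProduct {ns = ns} P y → F y)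
∀-tail {ns = []} P [] y₀∈ = record
  { mono   = λ f all y y∈ → f y (all y y∈)
  ; Ms     = []
  ; at     = []
  ; spec   = λ S → mk⇔ (λ { s [] _ → s }) (λ all → all [] λ ())
  ; unique = []
  }
∀-tail {ns = n ∷ ns} P (u₀ ∷ y₀) y₀∈ =
  cons-push (∀-head ns (P zero) (y₀∈ zero)) (∀-tail (λ j → P (suc j)) y₀ λ j → y₀∈ (suc j)) λ F → mk⇔
    (λ { all (u ∷ y) uy∈ → all y (λ j → uy∈ (suc j)) u (uy∈ zero) })
    (λ all y y∈ u u∈ → all (u ∷ y) λ { zero → u∈ ; (suc j) → y∈ j })

-- Ampleness from commutation

commute⇒labelAmple : ∀ {m} {ns : Vec ℕ m} → U ns → {S : SubsetU ns} →
                     SerialPushDownsCommute S → LabelAmple S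
commute⇒labelAmple [] {S} commute κ meets = record
  { W = λ () ; pick = λ () ; W⊆S = λ { [] _ → in-S (meets []) } }
  where
  in-S : (∃ λ y → T (S y) × _) → T (S [])
  in-S ([] , s , _) = s
commute⇒labelAmple {ns = n ∷ ns} (u₀ ∷ z₀) {S} commute κ meets = record
  { W    = λ { zero → P ; (suc j) → C.W j }
  ; pick = λ { zero v → w v , fromWitness (v , refl) , proj₁ (proj₂ (uniform v)) ; (suc j) v → C.pick j v }
  ; W⊆S  = λ { (u ∷ y) uy∈ → to (HeadPush.spec all-P S y) (C.W⊆S y λ j → uy∈ (suc j)) u (uy∈ zero) }
  }
  where
  κ′ : Labelling ns
  κ′ j = κ (suc j)

  -- The copies found for different `v` need not agree, so only the fact that the slice at `w` meets
  -- every box is retained; a common copy is found afterwards.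
  uniform : ∀ v → ∃ λ w → κ zero w ≡ κ zero v × Meets κ′ (λ y → S (w ∷ y))
  uniform v = let w , w∈ , W⊆ = to (quantifiers-swap some-Pv all-W commute)
                    (λ y y∈W → to (HeadPush.spec some-Pv S y) (C.W⊆S y y∈W))
              in w , toWitness w∈ , Copy.meets (record { W = C.W ; pick = C.pick ; W⊆S = W⊆ })
    where
    Pv : Fin n → Bool
    Pv u = ⌊ κ zero u ≟ℕ κ zero v ⌋

    some-Pv : HeadPush n ns (λ F → ∃ λ u → T (Pv u) × F u)
    some-Pv = ∃-head ns Pv {v} (fromWitness refl)

    copy : Copy κ′ (slice some-Pv S)
    copy = commute⇒labelAmple z₀ (slice-commute some-Pv commute) κ′ λ z → slice-meets (meets (v ∷ z))
      where
      slice-meets : ∀ {z : U ns} → (∃ λ y → T (S y) × ∀ j → κ j (lookup y j) ≡ κ j (lookup (v ∷ z) j)) →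
                    ∃ λ y → T (slice some-Pv S y) × ∀ j → κ′ j (lookup y j) ≡ κ′ j (lookup z j)
      slice-meets (u ∷ y , s , eq) =
        y , from (HeadPush.spec some-Pv S y) (u , fromWitness (eq zero) , s) , λ j → eq (suc j)
    module C = Copy copy

    y₀ : U ns
    y₀ = lookup⁻ λ j → proj₁ (C.pick j (lookup z₀ j))

    all-W : TailPush ns (λ F → ∀ y → InProduct {ns = ns} C.W y → F y)
    all-W = ∀-tail C.W y₀ λ j → subst (T ∘ C.W j)
      (sym (lookup∘lookup⁻ ns Fin (λ j → proj₁ (C.pick j (lookup z₀ j))) j))
      (proj₁ (proj₂ (C.pick j (lookup z₀ j))))

  w : Fin n → Fin n
  w v = proj₁ (uniform v)

  P : Fin n → Bool
  P u = ⌊ any? (λ v → u ≟ w v) ⌋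

  all-P : HeadPush n ns (λ F → ∀ u → T (P u) → F u)
  all-P = ∀-head ns P {w u₀} (fromWitness (u₀ , refl))

  copy : Copy κ′ (slice all-P S)
  copy = commute⇒labelAmple z₀ (slice-commute all-P commute) κ′ λ z →
    -- `same` describes the box of `z` as a product. Each slice over `P` has its own point in this
    -- box; exchanging the quantifiers gives a point common to all of them.
    let same : ∀ j → Fin (Vec.lookup ns j) → Bool
        same j v = ⌊ κ′ j v ≟ℕ κ′ j (lookup z j) ⌋
        y , y~z , s = from (quantifiers-swap all-P (∃-tail same z λ j → fromWitness refl) commute)
          λ u u∈P → let v , u≡wv = toWitness u∈P
                        y , s , y~z = proj₂ (proj₂ (uniform v)) z
                    in y , (λ j → fromWitness (y~z j)) , subst (λ u → T (S (u ∷ y))) (sym u≡wv) s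
    in y , from (HeadPush.spec all-P S y) s , λ j → toWitness (y~z j)
  module C = Copy copy

inhabitant : All NonZero ns → U ns
inhabitant = All.map λ { {suc n} _ → zero }

theorem4 : ∀ {m : ℕ} (ns : Vec ℕ m) → All NonZero ns →
    (S : SubsetU ns) → Ample S ⇔ SerialPushDownsCommute S
theorem4 ns nonZero S = mk⇔
  (λ ample → labelAmple⇒commute z₀ (ample⇒labelAmple ample))
  (λ commute → labelAmple⇒ample (commute⇒labelAmple z₀ commute))
  where
  z₀ = inhabitant nonZero
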